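{- Let $C$ be the capacity of the magazine and let $T_1,\dots,T_n$ be the sets of tools required for the jobs $1,\dots,n$. Then $$\min\{\mathrm{switches}(M) : M\in\mathbf{M}\} \;=\; \sum_{i=1}^{n}|T_i| \;-\; C \;-\; \max\{|\mathscr{P}(M)| : M\in\mathbf{M}\}.$$
   Context: Setting (Tool Loading Problem). $T=\{1,\dots,m\}$ is the set of tools and $J=\{1,\dots,n\}$ the set of jobs, processed in the order $1,2,\dots,n$. Job $i$ needs the set of tools $T_i\subseteq T$. The magazine has capacity $C$, a positive integer. Standing assumptions: $\bigcup_{i=1}^n T_i=T$ (so $m=|\bigcup_{i=1}^n T_i|$), $|T_i|\le C$ for all $i$, and $C<m$. $\mathbf{M}=\{M=(M_1,\dots,M_n): M_i\subseteq T,\ T_i\subseteq M_i,\ |M_i|=C \text{ for all } i\in J\}$ is the set of sequences of (full) magazine states. For $M\in\mathbf{M}$, $\mathrm{switches}(M)=\sum_{i=1}^{n-1}|M_{i+1}\setminus M_i|=\sum_{i=1}^{n-1}(C-|M_i\cap M_{i+1}|)$. For $M\in\mathbf{M}$ the set of pipes $\mathscr{P}(M)$ is the set of all triples $\pi_{s,e}^{t}=(s,e,t)$ with $1\le s<e\le n$, $t\in T_s\cap T_e$, $t\notin T_i$ for all $s<i<e$, and $t\in M_i$ for all $s<i<e$. (For $e=s+1$ the last two conditions are vacuous.) -}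

module Defs where

open import Data.Fin.Base using (Fin; suc; inject₁; _<_)
open import Data.Fin.Properties using (all?; _<?_)
open import Data.Fin.Subset using (Subset; _∈_; _∉_; _⊆_; _─_; ∣_∣)
open import Data.Fin.Subset.Properties using (_∈?_)
open import Data.List.Base using (List; length; filter; allFin; cartesianProduct)
open import Data.Nat.Base using (ℕ; zero; suc; _≤_)
open import Data.Nat.Properties using (+-0-commutativeMonoid)
open import Data.Product.Base using (∃; _×_; _,_)
open import Data.Vec.Functional using (Vector)
open import Level using (0ℓ)
open import Relation.Binary.PropositionalEquality using (_≡_)
open import Relation.Nullary.Decidable using (_×-dec_; _→-dec_; ¬?)
open import Relation.Unary using (Pred; Decidable)

open import Algebra.Properties.CommutativeMonoid.Sum +-0-commutativeMonoid public
  using (sum)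

private
  variable
    A : Set
    m n : ℕ

Image : (A → ℕ) → Pred A 0ℓ → Pred ℕ 0ℓ
Image f P k = ∃ λ x → P x × f x ≡ k

IsMin : Pred ℕ 0ℓ → ℕ → Set
IsMin S a = S a × (∀ b → S b → a ≤ b)

IsMax : Pred ℕ 0ℓ → ℕ → Set
IsMax S a = S a × (∀ b → S b → b ≤ a)

-- Tools are Fin m and jobs are Fin n, both counted from 0; a family of tool
-- sets indexed by the jobs is a Vector (Subset m) n.

𝐌 : ℕ → Vector (Subset m) n → Pred (Vector (Subset m) n) 0ℓ
𝐌 C T M = ∀ i → T i ⊆ M i × ∣ M i ∣ ≡ C

switches : Vector (Subset m) n → ℕ
switches {n = zero}  M = 0
switches {n = suc _} M = sum λ i → ∣ M (suc i) ─ M (inject₁ i) ∣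

IsPipe : (T M : Vector (Subset m) n) → Pred (Fin n × Fin n × Fin m) 0ℓ
IsPipe T M (s , e , t) =
  s < e ×
  (t ∈ T s × t ∈ T e) ×
  (∀ i → s < i → i < e → t ∉ T i) ×
  (∀ i → s < i → i < e → t ∈ M i)

isPipe? : (T M : Vector (Subset m) n) → Decidable (IsPipe T M)
isPipe? T M (s , e , t) =
  (s <? e) ×-dec
  ((t ∈? T s) ×-dec (t ∈? T e)) ×-dec
  all? (λ i → (s <? i) →-dec (i <? e) →-dec ¬? (t ∈? T i)) ×-dec
  all? (λ i → (s <? i) →-dec (i <? e) →-dec (t ∈? M i))

-- Every triple (s , e , t) is enumerated exactly once, so the length of this
-- list is the cardinality of the set of pipes.
𝒫 : (T M : Vector (Subset m) n) → List (Fin n × Fin n × Fin m)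
𝒫 {m} {n} T M =
  filter (isPipe? T M)
    (cartesianProduct (allFin n) (cartesianProduct (allFin n) (allFin m)))

#pipes : (T M : Vector (Subset m) n) → ℕ
#pipes T M = length (𝒫 T M)

{-# OPTIONS --safe #-}

-- Every use of a tool by a job closes a pipe, or is the first use of a tool of
-- the initial state, or has a switch since the previous use; charging uses to
-- these three gives ∑|Tᵢ| ≤ switches M + C + |𝒫 M| for every M ∈ 𝐌.
-- Conversely, keeping the tools that lie on a pipe of M and loading other tools
-- only when they are needed gives some M′ ∈ 𝐌 with
-- switches M′ + C + |𝒫 M| ≤ ∑|Tᵢ|, since a tool loaded for a job closes no pipe
-- of M there.  Applied to M with the most pipes, the two inequalities show that
-- M′ has the fewest switches and that equality holds.

module Submission where

open import Defs
open import Data.Bool.Base using (if_then_else_)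
open import Data.Empty using (⊥-elim)
open import Data.Fin.Base as Fin using (Fin; zero; suc)
open import Data.Fin.Properties using (all?; _<?_)
open import Data.Fin.Subset using (Subset; inside; outside; ⊤; ⊥; ⋃; ∣_∣; _∈_; _∉_; _⊆_; _∪_; _∩_; _─_)
open import Data.Fin.Subset.Properties
open import Data.Integer.Base using (+_; _-_)
open import Data.Integer.Properties using ([+m]-[+n]≡m⊖n; ⊖-≥)
open import Data.List.Base using (List; []; _∷_; _++_; length; filter; map; tabulate; allFin; cartesianProduct)
open import Data.List.Properties using (filter-++; length-++)
open import Data.Nat.Base using (ℕ; zero; suc; _+_; _≤_; _<_; z≤n; s≤s)
open import Data.Nat.Properties hiding (_<?_)
open import Data.Nat.Solver using (module +-*-Solver)
open import Data.Product.Base using (∃; ∃₂; _×_; _,_; proj₁; proj₂)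
open import Data.Sum.Base using (_⊎_; inj₁; inj₂; [_,_]′)
open import Data.Vec.Base using ([]; _∷_; here; there)
open import Data.Vec.Functional as Vector using (Vector; toList; tail)
open import Function.Base using (_∘_; id)
open import Level using (0ℓ)
open import Relation.Binary.PropositionalEquality using (_≡_; refl; sym; trans; cong; cong₂; subst; module ≡-Reasoning)
open import Relation.Nullary.Decidable using (Dec; yes; no; does; _×-dec_; _→-dec_; ¬?)
open import Relation.Nullary.Negation using (¬_; contradiction)
open import Relation.Unary using (Pred; Decidable)

open import Algebra.Properties.CommutativeMonoid.Sum +-0-commutativeMonoid
  using (sum-cong-≗; ∑-distrib-+; sum-replicate-zero)

private
  variable
    A B P Q R : Set
    m n : ℕ

-- Cardinalities of subsets

∣p∣≡∣p∩q∣+∣p─q∣ : ∀ (p q : Subset m) → ∣ p ∣ ≡ ∣ p ∩ q ∣ + ∣ p ─ q ∣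
∣p∣≡∣p∩q∣+∣p─q∣ []            []            = refl
∣p∣≡∣p∩q∣+∣p─q∣ (outside ∷ p) (outside ∷ q) = ∣p∣≡∣p∩q∣+∣p─q∣ p q
∣p∣≡∣p∩q∣+∣p─q∣ (outside ∷ p) (inside  ∷ q) = ∣p∣≡∣p∩q∣+∣p─q∣ p q
∣p∣≡∣p∩q∣+∣p─q∣ (inside  ∷ p) (outside ∷ q) =
  trans (cong suc (∣p∣≡∣p∩q∣+∣p─q∣ p q)) (sym (+-suc ∣ p ∩ q ∣ ∣ p ─ q ∣))
∣p∣≡∣p∩q∣+∣p─q∣ (inside  ∷ p) (inside  ∷ q) = cong suc (∣p∣≡∣p∩q∣+∣p─q∣ p q)

∣p∪q∣≤∣p∣+∣q∣ : ∀ (p q : Subset m) → ∣ p ∪ q ∣ ≤ ∣ p ∣ + ∣ q ∣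
∣p∪q∣≤∣p∣+∣q∣ []            []            = z≤n
∣p∪q∣≤∣p∣+∣q∣ (outside ∷ p) (outside ∷ q) = ∣p∪q∣≤∣p∣+∣q∣ p q
∣p∪q∣≤∣p∣+∣q∣ (outside ∷ p) (inside  ∷ q) =
  ≤-trans (s≤s (∣p∪q∣≤∣p∣+∣q∣ p q)) (≤-reflexive (sym (+-suc ∣ p ∣ ∣ q ∣)))
∣p∪q∣≤∣p∣+∣q∣ (inside  ∷ p) (outside ∷ q) = s≤s (∣p∪q∣≤∣p∣+∣q∣ p q)
∣p∪q∣≤∣p∣+∣q∣ (inside  ∷ p) (inside  ∷ q) =
  s≤s (≤-trans (∣p∪q∣≤∣p∣+∣q∣ p q) (+-monoʳ-≤ ∣ p ∣ (n≤1+n ∣ q ∣)))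

x∈p─q⇒x∉q : ∀ (p q : Subset m) {x} → x ∈ p ─ q → x ∉ q
x∈p─q⇒x∉q (_ ∷ p) (_ ∷ q) (there x∈p─q) (there x∈q) = x∈p─q⇒x∉q p q x∈p─q x∈q
x∈p─q⇒x∉q (_ ∷ p) (inside ∷ q) () here

p∪q⊆r : {p q r : Subset m} → p ⊆ r → q ⊆ r → p ∪ q ⊆ r
p∪q⊆r {p = p} {q} p⊆r q⊆r = [ p⊆r , q⊆r ]′ ∘ x∈p∪q⁻ p q

disjoint⇒∣p∣+∣q∣≤∣r∣ : {p q r : Subset m} → (∀ {x} → x ∈ p → x ∉ q) →
                       p ⊆ r → q ⊆ r → ∣ p ∣ + ∣ q ∣ ≤ ∣ r ∣
disjoint⇒∣p∣+∣q∣≤∣r∣ {p = p} {q} {r} p#q p⊆r q⊆r = begin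
  ∣ p ∣ + ∣ q ∣         ≤⟨ +-mono-≤ (p⊆q⇒∣p∣≤∣q∣ λ x∈p → x∈p∩q⁺ (p⊆r x∈p , x∈p))
                                    (p⊆q⇒∣p∣≤∣q∣ λ x∈q → x∈p∧x∉q⇒x∈p─q (q⊆r x∈q) λ x∈p → p#q x∈p x∈q) ⟩
  ∣ r ∩ p ∣ + ∣ r ─ p ∣ ≡⟨ ∣p∣≡∣p∩q∣+∣p─q∣ r p ⟨
  ∣ r ∣                 ∎
  where open ≤-Reasoning

disjoint⇒∣p∣+∣q∣≤∣r∣+∣s∣ : {p q : Subset m} (r s : Subset m) → (∀ {x} → x ∈ p → x ∉ q) →
                           p ⊆ r ∪ s → q ⊆ r ∪ s → ∣ p ∣ + ∣ q ∣ ≤ ∣ r ∣ + ∣ s ∣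
disjoint⇒∣p∣+∣q∣≤∣r∣+∣s∣ r s p#q p⊆r∪s q⊆r∪s =
  ≤-trans (disjoint⇒∣p∣+∣q∣≤∣r∣ p#q p⊆r∪s q⊆r∪s) (∣p∪q∣≤∣p∣+∣q∣ r s)

∣p∣≡∣q∣⇒∣p─q∣≡∣q─p∣ : ∀ (p q : Subset m) → ∣ p ∣ ≡ ∣ q ∣ → ∣ p ─ q ∣ ≡ ∣ q ─ p ∣
∣p∣≡∣q∣⇒∣p─q∣≡∣q─p∣ p q ∣p∣≡∣q∣ = +-cancelˡ-≡ ∣ p ∩ q ∣ _ _ (begin
  ∣ p ∩ q ∣ + ∣ p ─ q ∣ ≡⟨ ∣p∣≡∣p∩q∣+∣p─q∣ p q ⟨
  ∣ p ∣                 ≡⟨ ∣p∣≡∣q∣ ⟩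
  ∣ q ∣                 ≡⟨ ∣p∣≡∣p∩q∣+∣p─q∣ q p ⟩
  ∣ q ∩ p ∣ + ∣ q ─ p ∣ ≡⟨ cong (λ r → ∣ r ∣ + ∣ q ─ p ∣) (∩-comm q p) ⟩
  ∣ p ∩ q ∣ + ∣ q ─ p ∣ ∎)
  where open ≡-Reasoning

interpolate : ∀ {c} {p q : Subset m} → p ⊆ q → ∣ p ∣ ≤ c → c ≤ ∣ q ∣ →
              ∃ λ r → p ⊆ r × r ⊆ q × ∣ r ∣ ≡ c
interpolate {p = []} {[]} p⊆q _ z≤n = [] , id , id , refl
interpolate {p = outside ∷ p} {outside ∷ q} p⊆q p≤c c≤q
  with r , p⊆r , r⊆q , eq ← interpolate (drop-∷-⊆ p⊆q) p≤c c≤q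
  = outside ∷ r , s⊆s p⊆r , s⊆s r⊆q , eq
interpolate {p = inside ∷ p} {outside ∷ q} p⊆q _ _ = contradiction (p⊆q here) λ ()
interpolate {p = inside ∷ p} {inside ∷ q} p⊆q (s≤s p≤c) (s≤s c≤q)
  with r , p⊆r , r⊆q , eq ← interpolate (drop-∷-⊆ p⊆q) p≤c c≤q
  = inside ∷ r , s⊆s p⊆r , s⊆s r⊆q , cong suc eq
interpolate {c = c} {p = outside ∷ p} {inside ∷ q} p⊆q p≤c c≤1+q with c ≤? ∣ q ∣
... | yes c≤q with r , p⊆r , r⊆q , eq ← interpolate (drop-∷-⊆ p⊆q) p≤c c≤q
  = outside ∷ r , s⊆s p⊆r , out⊆ r⊆q , eq
-- Here `c` exceeds `∣ q ∣` by exactly one, so the whole of `inside ∷ q` is the only choice.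
... | no c≰q = inside ∷ q , out⊆ (drop-∷-⊆ p⊆q) , id , ≤-antisym (≰⇒> c≰q) c≤1+q

-- Exhaustive search, deciding membership one tool at a time. Either branch may contain no
-- admissible set, hence the case split before the best of each branch can be compared.
argmax : {P : Pred (Subset m) 0ℓ} → Decidable P → (f : Subset m → ℕ) → ∃ P →
         ∃ λ p → P p × (∀ q → P q → f q ≤ f p)
argmax {zero} P? f ([] , P[]) = [] , P[] , λ { [] _ → ≤-refl }
argmax {suc m} {P} P? f (p , Pp)
  with anySubset? (P? ∘ (outside ∷_)) | anySubset? (P? ∘ (inside ∷_))
... | no ¬o | no ¬i = ⊥-elim (split p Pp)
  where
  split : ∀ p → ¬ P p
  split (outside ∷ p) Pp = ¬o (p , Pp)
  split (inside  ∷ p) Pp = ¬i (p , Pp)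
... | yes o | no ¬i with r , Pr , r-max ← argmax (P? ∘ (outside ∷_)) (f ∘ (outside ∷_)) o =
  outside ∷ r , Pr , λ { (outside ∷ q) → r-max q ; (inside ∷ q) Pq → contradiction (q , Pq) ¬i }
... | no ¬o | yes i with r , Pr , r-max ← argmax (P? ∘ (inside ∷_)) (f ∘ (inside ∷_)) i =
  inside ∷ r , Pr , λ { (inside ∷ q) → r-max q ; (outside ∷ q) Pq → contradiction (q , Pq) ¬o }
... | yes o | yes i
  with r , Pr , r-max ← argmax (P? ∘ (outside ∷_)) (f ∘ (outside ∷_)) o
     | s , Ps , s-max ← argmax (P? ∘ (inside ∷_)) (f ∘ (inside ∷_)) i
  with ≤-total (f (outside ∷ r)) (f (inside ∷ s))
... | inj₁ r≤s = inside ∷ s , Ps ,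
  λ { (outside ∷ q) Pq → ≤-trans (r-max q Pq) r≤s ; (inside ∷ q) → s-max q }
... | inj₂ s≤r = outside ∷ r , Pr ,
  λ { (outside ∷ q) → r-max q ; (inside ∷ q) Pq → ≤-trans (s-max q Pq) s≤r }

-- X is the set of tools held in the magazine without interruption since their
-- last use; the next job closes a pipe for each of them that it uses.
held : (X T M : Subset m) → Subset m
held X T M = T ∪ (X ∩ M)

-- Counts each pipe at the job where it ends, including those already open on entry with tools in
-- `X`. For `X` equal to `⊥` this is `#pipes`, in a form suited to induction on the jobs.
pipeCount : Subset m → (T M : Vector (Subset m) n) → ℕ
pipeCount {n = zero}  X T M = 0
pipeCount {n = suc n} X T M =
  ∣ X ∩ T zero ∣ + pipeCount (held X (T zero) (M zero)) (tail T) (tail M)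

-- The pipe count as a sum of indicators

𝟙 : Dec P → ℕ
𝟙 p? = if does p? then 1 else 0

𝟙-no : (p? : Dec P) → ¬ P → 𝟙 p? ≡ 0
𝟙-no (yes p) ¬p = contradiction p ¬p
𝟙-no (no _)  ¬p = refl

𝟙-cong : (p? : Dec P) (q? : Dec Q) → (P → Q) → (Q → P) → 𝟙 p? ≡ 𝟙 q?
𝟙-cong (yes p) (yes q) _ _ = refl
𝟙-cong (yes p) (no ¬q) f _ = contradiction (f p) ¬q
𝟙-cong (no ¬p) (yes q) _ g = contradiction (g q) ¬p
𝟙-cong (no ¬p) (no ¬q) _ _ = refl

𝟙-⊎ : (p? : Dec P) (q? : Dec Q) (r? : Dec R) →
      (P → ¬ Q) → (P → R) → (Q → R) → (R → P ⊎ Q) → 𝟙 p? + 𝟙 q? ≡ 𝟙 r?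
𝟙-⊎ (yes p) (yes q) _ p#q _ _ _ = contradiction q (p#q p)
𝟙-⊎ (yes p) (no _) r? _ f _ _ = 𝟙-cong (yes p) r? f (λ _ → p)
𝟙-⊎ (no ¬p) q? r? _ _ g h = 𝟙-cong q? r? g ([ (λ p → contradiction p ¬p) , id ]′ ∘ h)

sum-zero : (f : Vector ℕ n) → (∀ i → f i ≡ 0) → sum f ≡ 0
sum-zero {n} f f≡0 = trans (sum-cong-≗ f≡0) (sum-replicate-zero n)

sum-∈? : (p : Subset m) → sum (λ t → 𝟙 (t ∈? p)) ≡ ∣ p ∣
sum-∈? []            = refl
sum-∈? (outside ∷ p) = trans
  (sum-cong-≗ λ t → 𝟙-cong (suc t ∈? (outside ∷ p)) (t ∈? p) drop-there there) (sum-∈? p)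
sum-∈? (inside  ∷ p) = cong suc (trans
  (sum-cong-≗ λ t → 𝟙-cong (suc t ∈? (inside ∷ p)) (t ∈? p) drop-there there) (sum-∈? p))

length-filter-tabulate : {P : Pred A 0ℓ} (P? : Decidable P) (f : Fin n → A) →
                         length (filter P? (tabulate f)) ≡ sum λ i → 𝟙 (P? (f i))
length-filter-tabulate {n = zero}  P? f = refl
length-filter-tabulate {n = suc n} P? f with P? (f zero)
... | yes _ = cong suc (length-filter-tabulate P? (f ∘ suc))
... | no  _ = length-filter-tabulate P? (f ∘ suc)

length-filter-map : {P : Pred B 0ℓ} (P? : Decidable P) (f : A → B) (xs : List A) →
                    length (filter P? (map f xs)) ≡ length (filter (P? ∘ f) xs)
length-filter-map P? f []       = refl
length-filter-map P? f (x ∷ xs) with P? (f x)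
... | yes _ = cong suc (length-filter-map P? f xs)
... | no  _ = length-filter-map P? f xs

length-filter-× : {P : Pred (A × B) 0ℓ} (P? : Decidable P) (f : Fin n → A) (ys : List B) →
                  length (filter P? (cartesianProduct (tabulate f) ys)) ≡
                  sum λ i → length (filter (P? ∘ (f i ,_)) ys)
length-filter-× {n = zero}  P? f ys = refl
length-filter-× {n = suc n} P? f ys = begin
  length (filter P? (xs₀ ++ xs₊))
    ≡⟨ cong length (filter-++ P? xs₀ xs₊) ⟩
  length (filter P? xs₀ ++ filter P? xs₊)
    ≡⟨ length-++ (filter P? xs₀) ⟩
  length (filter P? xs₀) + length (filter P? xs₊)
    ≡⟨ cong₂ _+_ (length-filter-map P? (f zero ,_) ys) (length-filter-× P? (f ∘ suc) ys) ⟩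
  sum (λ i → length (filter (P? ∘ (f i ,_)) ys)) ∎
  where
  open ≡-Reasoning
  xs₀ = map (f zero ,_) ys
  xs₊ = cartesianProduct (tabulate (f ∘ suc)) ys

#pipes-sum : (T M : Vector (Subset m) n) →
             #pipes T M ≡ sum λ s → sum λ e → sum λ t → 𝟙 (isPipe? T M (s , e , t))
#pipes-sum {m} {n} T M = begin
  #pipes T M
    ≡⟨ length-filter-× (isPipe? T M) id (cartesianProduct (allFin n) (allFin m)) ⟩
  sum (λ s → length (filter (isPipe? T M ∘ (s ,_)) (cartesianProduct (allFin n) (allFin m))))
    ≡⟨ sum-cong-≗ (λ s → trans
         (length-filter-× (isPipe? T M ∘ (s ,_)) id (allFin m))
         (sum-cong-≗ λ e → length-filter-tabulate (λ t → isPipe? T M (s , e , t)) id)) ⟩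
  sum (λ s → sum λ e → sum λ t → 𝟙 (isPipe? T M (s , e , t))) ∎
  where open ≡-Reasoning

-- Pipes that started before the first job, with the tools in X on their way.
IsIncoming : Subset m → (T M : Vector (Subset m) n) → Pred (Fin n × Fin m) 0ℓ
IsIncoming X T M (e , t) =
  t ∈ X × t ∈ T e × (∀ i → i Fin.< e → t ∉ T i) × (∀ i → i Fin.< e → t ∈ M i)

isIncoming? : (X : Subset m) (T M : Vector (Subset m) n) → Decidable (IsIncoming X T M)
isIncoming? X T M (e , t) =
  (t ∈? X) ×-dec (t ∈? T e) ×-dec
  all? (λ i → (i <? e) →-dec ¬? (t ∈? T i)) ×-dec
  all? (λ i → (i <? e) →-dec (t ∈? M i))

module _ (T M : Vector (Subset m) (suc n)) where

  pipe-tail : ∀ s e t → 𝟙 (isPipe? T M (suc s , suc e , t)) ≡ 𝟙 (isPipe? (tail T) (tail M) (s , e , t))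
  pipe-tail s e t = 𝟙-cong (isPipe? T M (suc s , suc e , t)) (isPipe? (tail T) (tail M) (s , e , t))
    (λ { (s≤s s<e , uses , unused , kept) → s<e , uses ,
         (λ i s<i i<e → unused (suc i) (s≤s s<i) (s≤s i<e)) ,
         (λ i s<i i<e → kept (suc i) (s≤s s<i) (s≤s i<e)) })
    (λ { (s<e , uses , unused , kept) → s≤s s<e , uses ,
         (λ { (suc i) (s≤s s<i) (s≤s i<e) → unused i s<i i<e }) ,
         (λ { (suc i) (s≤s s<i) (s≤s i<e) → kept i s<i i<e }) })

  incoming-tail : ∀ X e t →
    𝟙 (isPipe? T M (zero , suc e , t)) + 𝟙 (isIncoming? X T M (suc e , t)) ≡
    𝟙 (isIncoming? (held X (T zero) (M zero)) (tail T) (tail M) (e , t))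
  incoming-tail X e t = 𝟙-⊎
    (isPipe? T M (zero , suc e , t)) (isIncoming? X T M (suc e , t))
    (isIncoming? (held X (T zero) (M zero)) (tail T) (tail M) (e , t))
    (λ { (_ , (t∈T₀ , _) , _) (_ , _ , unused , _) → unused zero (s≤s z≤n) t∈T₀ })
    (λ { (_ , (t∈T₀ , t∈Te) , unused , kept) → x∈p∪q⁺ (inj₁ t∈T₀) , t∈Te ,
         (λ i i<e → unused (suc i) (s≤s z≤n) (s≤s i<e)) ,
         (λ i i<e → kept (suc i) (s≤s z≤n) (s≤s i<e)) })
    (λ { (t∈X , t∈Te , unused , kept) →
         x∈p∪q⁺ (inj₂ (x∈p∩q⁺ (t∈X , kept zero (s≤s z≤n)))) , t∈Te ,
         (λ i i<e → unused (suc i) (s≤s i<e)) ,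
         (λ i i<e → kept (suc i) (s≤s i<e)) })
    split
    where
    split : IsIncoming (held X (T zero) (M zero)) (tail T) (tail M) (e , t) →
            IsPipe T M (zero , suc e , t) ⊎ IsIncoming X T M (suc e , t)
    split (t∈held , t∈Te , unused , kept) with t ∈? T zero
    ... | yes t∈T₀ = inj₁ (s≤s z≤n , (t∈T₀ , t∈Te) ,
      (λ { (suc i) _ (s≤s i<e) → unused i i<e }) ,
      (λ { (suc i) _ (s≤s i<e) → kept i i<e }))
    ... | no t∉T₀ with x∈p∪q⁻ (T zero) _ t∈held
    ...   | inj₁ t∈T₀ = contradiction t∈T₀ t∉T₀
    ...   | inj₂ t∈X∩M₀ with t∈X , t∈M₀ ← x∈p∩q⁻ X _ t∈X∩M₀ = inj₂ (t∈X , t∈Te ,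
      (λ { zero _ → t∉T₀ ; (suc i) (s≤s i<e) → unused i i<e }) ,
      (λ { zero _ → t∈M₀ ; (suc i) (s≤s i<e) → kept i i<e }))

-- Splitting off job `zero` leaves four blocks: incoming pipes that end there, pipes that start
-- there, pipes among later jobs, and incoming pipes that end later. The second and fourth together
-- are the incoming pipes of the tail.
pipeCount-sum : ∀ X (T M : Vector (Subset m) n) →
  pipeCount X T M ≡
  (sum λ s → sum λ e → sum λ t → 𝟙 (isPipe? T M (s , e , t))) +
  (sum λ e → sum λ t → 𝟙 (isIncoming? X T M (e , t)))
pipeCount-sum {n = zero}  X T M = refl
pipeCount-sum {m} {suc n} X T M = begin
  ∣ X ∩ T zero ∣ + pipeCount K (tail T) (tail M)
    ≡⟨ cong₂ _+_ first-eq (trans (pipeCount-sum K (tail T) (tail M)) (cong₂ _+_ later-eq incoming-eq)) ⟩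
  first + (later + (fromZero + incoming))
    ≡⟨ solve 4 (λ a b c d → a :+ (b :+ (c :+ d)) := c :+ b :+ (a :+ d)) refl first later fromZero incoming ⟩
  fromZero + later + (first + incoming)
    -- No pipe has `s` and `e` both `zero`, so the term missing from `fromZero` is 0.
    ≡⟨ cong (λ k → k + fromZero + later + (first + incoming)) (sum-zero {m} _ λ t → 𝟙-no (isPipe? T M (zero , zero , t)) λ ()) ⟨
  (sum λ s → sum λ e → sum λ t → 𝟙 (isPipe? T M (s , e , t))) +
  (sum λ e → sum λ t → 𝟙 (isIncoming? X T M (e , t))) ∎
  where
  open ≡-Reasoning
  open +-*-Solver
  K = held X (T zero) (M zero)
  first    = sum λ t → 𝟙 (isIncoming? X T M (zero , t))
  fromZero = sum λ e → sum λ t → 𝟙 (isPipe? T M (zero , suc e , t))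
  incoming = sum λ e → sum λ t → 𝟙 (isIncoming? X T M (suc e , t))
  later    = sum λ s → sum λ e → sum λ t → 𝟙 (isPipe? T M (suc s , e , t))

  first-eq : ∣ X ∩ T zero ∣ ≡ first
  first-eq = trans (sym (sum-∈? (X ∩ T zero))) (sum-cong-≗ λ t →
    𝟙-cong (t ∈? (X ∩ T zero)) (isIncoming? X T M (zero , t))
      (λ t∈X∩T₀ → let t∈X , t∈T₀ = x∈p∩q⁻ X (T zero) t∈X∩T₀ in t∈X , t∈T₀ , (λ _ ()) , (λ _ ()))
      (λ { (t∈X , t∈T₀ , _) → x∈p∩q⁺ (t∈X , t∈T₀) }))

  later-eq : (sum λ s → sum λ e → sum λ t → 𝟙 (isPipe? (tail T) (tail M) (s , e , t))) ≡ later
  later-eq = sum-cong-≗ λ s → sym (cong₂ _+_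
    (sum-zero {m} _ λ t → 𝟙-no (isPipe? T M (suc s , zero , t)) λ ())
    (sum-cong-≗ λ e → sum-cong-≗ λ t → pipe-tail T M s e t))

  incoming-eq : (sum λ e → sum λ t → 𝟙 (isIncoming? K (tail T) (tail M) (e , t))) ≡ fromZero + incoming
  incoming-eq = sym (trans (sym (∑-distrib-+ {n} _ _)) (sum-cong-≗ λ e →
    trans (sym (∑-distrib-+ {m} _ _)) (sum-cong-≗ λ t → incoming-tail T M X e t)))

#pipes≡pipeCount : (T M : Vector (Subset m) n) → #pipes T M ≡ pipeCount ⊥ T M
#pipes≡pipeCount {m} {n} T M = begin
  #pipes T M      ≡⟨ #pipes-sum T M ⟩
  pipes           ≡⟨ +-identityʳ pipes ⟨
  pipes + 0       ≡⟨ cong (_+_ pipes) (sum-zero {n} _ λ e → sum-zero {m} _ λ t →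
                       𝟙-no (isIncoming? ⊥ T M (e , t)) (∉⊥ ∘ proj₁)) ⟨
  pipes + _       ≡⟨ pipeCount-sum ⊥ T M ⟨
  pipeCount ⊥ T M ∎
  where
  open ≡-Reasoning
  pipes = sum λ s → sum λ e → sum λ t → 𝟙 (isPipe? T M (s , e , t))

-- Optimal magazine states

-- Needed because `M zero Vector.∷ tail M` agrees with `M` only pointwise.
switches-cong : {M N : Vector (Subset m) n} → (∀ i → M i ≡ N i) → switches M ≡ switches N
switches-cong {n = zero}  M≗N = refl
switches-cong {n = suc n} M≗N =
  sum-cong-≗ λ i → cong₂ (λ p q → ∣ p ─ q ∣) (M≗N (suc i)) (M≗N (Fin.inject₁ i))

-- A use of a tool either closes a pipe, or uses up an idle tool (one in Y ─ X),
-- or is preceded by a switch since the last use.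
∑∣T∣≤pipeCount+idle+switches : ∀ X Y (T M : Vector (Subset m) n) → (∀ i → T i ⊆ M i) →
  sum (λ i → ∣ T i ∣) ≤ pipeCount X T M + ∣ Y ─ X ∣ + switches (Y Vector.∷ M)
∑∣T∣≤pipeCount+idle+switches {n = zero} X Y T M T⊆M = z≤n
∑∣T∣≤pipeCount+idle+switches {n = suc n} X Y T M T⊆M = begin
  ∣ T₀ ∣ + S
    ≤⟨ +-mono-≤ (≤-reflexive (trans (∣p∣≡∣p∩q∣+∣p─q∣ T₀ X) (cong (λ p → ∣ p ∣ + r) (∩-comm T₀ X))))
                (∑∣T∣≤pipeCount+idle+switches K M₀ (tail T) (tail M) (T⊆M ∘ suc)) ⟩
  (x + r) + (c + ∣ M₀ ─ K ∣ + switches (M₀ Vector.∷ tail M))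
    ≡⟨ cong (λ k → x + r + (c + ∣ M₀ ─ K ∣ + k)) (switches-cong {M = M₀ Vector.∷ tail M} {M} λ { zero → refl ; (suc i) → refl }) ⟩
  (x + r) + (c + ∣ M₀ ─ K ∣ + s)
    ≡⟨ solve 5 (λ x r c k s → (x :+ r) :+ (c :+ k :+ s) := (r :+ k) :+ (x :+ c :+ s)) refl x r c ∣ M₀ ─ K ∣ s ⟩
  (r + ∣ M₀ ─ K ∣) + (x + c + s)
    -- The uses that close no pipe, `T₀ ─ X`, and the tools idle afterwards, `M₀ ─ K`, are disjoint
    -- since `T₀ ⊆ K`. Both lie in `M₀` outside `X`, so each of their tools was idle in `Y` or has
    -- just been switched in.
    ≤⟨ +-monoˡ-≤ (x + c + s) (disjoint⇒∣p∣+∣q∣≤∣r∣+∣s∣ (Y ─ X) (M₀ ─ Y) 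
        (λ t∈T₀─X t∈M₀─K → x∈p─q⇒x∉q M₀ K t∈M₀─K (x∈p∪q⁺ (inj₁ (p─q⊆p T₀ X t∈T₀─X))))
        (λ t∈T₀─X → fresh (T⊆M zero (p─q⊆p T₀ X t∈T₀─X)) (x∈p─q⇒x∉q T₀ X t∈T₀─X))
        (λ t∈M₀─K → let t∈M₀ = p─q⊆p M₀ K t∈M₀─K in
          fresh t∈M₀ λ t∈X → x∈p─q⇒x∉q M₀ K t∈M₀─K (x∈p∪q⁺ (inj₂ (x∈p∩q⁺ (t∈X , t∈M₀)))))) ⟩
  (∣ Y ─ X ∣ + ∣ M₀ ─ Y ∣) + (x + c + s)
    ≡⟨ solve 5 (λ y d x c s → (y :+ d) :+ (x :+ c :+ s) := x :+ c :+ y :+ (d :+ s)) refl ∣ Y ─ X ∣ ∣ M₀ ─ Y ∣ x c s ⟩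
  x + c + ∣ Y ─ X ∣ + (∣ M₀ ─ Y ∣ + s) ∎
  where
  open ≤-Reasoning
  open +-*-Solver
  T₀ = T zero
  M₀ = M zero
  K  = held X T₀ M₀
  S  = sum λ i → ∣ T (suc i) ∣
  x  = ∣ X ∩ T₀ ∣
  r  = ∣ T₀ ─ X ∣
  c  = pipeCount K (tail T) (tail M)
  s  = switches M

  fresh : ∀ {t} → t ∈ M₀ → t ∉ X → t ∈ (Y ─ X) ∪ (M₀ ─ Y)
  fresh {t} t∈M₀ t∉X with t ∈? Y
  ... | yes t∈Y = x∈p∪q⁺ (inj₁ (x∈p∧x∉q⇒x∈p─q t∈Y t∉X))
  ... | no  t∉Y = x∈p∪q⁺ (inj₂ (x∈p∧x∉q⇒x∈p─q t∈M₀ t∉Y))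

-- Construction of states with few switches

-- One loading step: `p` has to be present, and the old content `q` is kept as far as the capacity
-- `c` allows. The last alternative records that a tool is dropped only if the result is full.
truncate : ∀ {c} (p q : Subset m) → ∣ p ∣ ≤ c →
           ∃ λ r → p ⊆ r × r ⊆ p ∪ q × ∣ r ∣ ≤ c × (∣ r ∣ ≡ c ⊎ p ∪ q ⊆ r)
truncate {c = c} p q ∣p∣≤c with c ≤? ∣ p ∪ q ∣
... | yes c≤∣p∪q∣ with r , p⊆r , r⊆p∪q , ∣r∣≡c ← interpolate (p⊆p∪q q) ∣p∣≤c c≤∣p∪q∣ =
  r , p⊆r , r⊆p∪q , ≤-reflexive ∣r∣≡c , inj₁ ∣r∣≡c
... | no  c≰∣p∪q∣ = p ∪ q , p⊆p∪q q , id , <⇒≤ (≰⇒> c≰∣p∪q∣) , inj₂ id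

-- The invariant that makes the last content full: a magazine not yet full holds every tool that no
-- remaining job needs. With no jobs left, the second alternative would put all `m` tools into `Y`,
-- against `∣ Y ∣ ≤ C < m`.
FullOrCovers : ℕ → Subset m → Vector (Subset m) n → Set
FullOrCovers C Y T = ∣ Y ∣ ≡ C ⊎ (∀ t → t ∈ Y ⊎ ∃ λ i → t ∈ T i)

fullOrCovers-tail : ∀ {C} (K Y Z : Subset m) (T : Vector (Subset m) (suc n)) → T zero ⊆ Z →
                    ∣ Z ∣ ≤ C → ∣ Z ∣ ≡ C ⊎ K ∪ Y ⊆ Z →
                    FullOrCovers C Y T → FullOrCovers C Z (tail T)
fullOrCovers-tail K Y Z T T₀⊆Z ∣Z∣≤C (inj₁ ∣Z∣≡C) _ = inj₁ ∣Z∣≡C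
fullOrCovers-tail K Y Z T T₀⊆Z ∣Z∣≤C (inj₂ K∪Y⊆Z) (inj₁ ∣Y∣≡C) =
  inj₁ (≤-antisym ∣Z∣≤C (subst (_≤ ∣ Z ∣) ∣Y∣≡C (p⊆q⇒∣p∣≤∣q∣ (K∪Y⊆Z ∘ q⊆p∪q K Y))))
fullOrCovers-tail K Y Z T T₀⊆Z ∣Z∣≤C (inj₂ K∪Y⊆Z) (inj₂ covers) = inj₂ (covers′ ∘ covers)
  where
  covers′ : ∀ {t} → t ∈ Y ⊎ (∃ λ i → t ∈ T i) → t ∈ Z ⊎ ∃ λ i → t ∈ T (suc i)
  covers′ (inj₁ t∈Y)            = inj₁ (K∪Y⊆Z (q⊆p∪q K Y t∈Y))
  covers′ (inj₂ (zero , t∈T₀))  = inj₁ (T₀⊆Z t∈T₀)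
  covers′ (inj₂ (suc i , t∈Ti)) = inj₂ (i , t∈Ti)

-- Running forward, Y is the content of a partially filled magazine that keeps
-- everything held by M and otherwise only loads tools needed immediately; no
-- tool is dropped before Y is full.  Running backward, each Y is filled up to
-- C with tools of its successor, so the filling costs no switches.
tight-states : ∀ {C} X Y (T M : Vector (Subset m) n) → 𝐌 C T M → C < m →
  X ⊆ Y → ∣ Y ∣ ≤ C → FullOrCovers C Y T →
  ∃₂ λ Y′ (M′ : Vector (Subset m) n) → 𝐌 C T M′ × Y ⊆ Y′ × ∣ Y′ ∣ ≡ C ×
    switches (Y′ Vector.∷ M′) + C + pipeCount X T M ≤ sum (λ i → ∣ T i ∣) + ∣ Y ∣
tight-states {n = zero} {C} X Y T M M∈𝐌 C<m X⊆Y ∣Y∣≤C full =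
  Y , M , M∈𝐌 , id , ∣Y∣≡C full , ≤-reflexive (trans (+-identityʳ C) (sym (∣Y∣≡C full)))
  where
  ∣Y∣≡C : FullOrCovers C Y T → ∣ Y ∣ ≡ C
  ∣Y∣≡C (inj₁ eq)  = eq
  ∣Y∣≡C (inj₂ cov) = contradiction (≤-trans C<m (≤-trans m≤∣Y∣ ∣Y∣≤C)) (<-irrefl refl)
    where
    m≤∣Y∣ = subst (_≤ ∣ Y ∣) (∣⊤∣≡n _) (p⊆q⇒∣p∣≤∣q∣ {p = ⊤} λ {t} _ → [ id , (λ ()) ]′ (cov t))
tight-states {n = suc n} {C} X Y T M M∈𝐌 C<m X⊆Y ∣Y∣≤C full
  -- The held tools fit because they all lie in `M zero`, which has size `C`.
  with Z , K⊆Z , Z⊆K∪Y , ∣Z∣≤C , Z-full ← truncate (held X (T zero) (M zero)) Y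
    (subst (∣ held X (T zero) (M zero) ∣ ≤_) (proj₂ (M∈𝐌 zero))
      (p⊆q⇒∣p∣≤∣q∣ (p∪q⊆r (proj₁ (M∈𝐌 zero)) (p∩q⊆q X (M zero)))))
  with Z′ , M′ , M′∈𝐌 , Z⊆Z′ , ∣Z′∣≡C , bound ←
    tight-states (held X (T zero) (M zero)) Z (tail T) (tail M) (M∈𝐌 ∘ suc) C<m K⊆Z ∣Z∣≤C
      (fullOrCovers-tail _ Y Z T (λ t∈T₀ → K⊆Z (p⊆p∪q _ t∈T₀)) ∣Z∣≤C Z-full full)
  with Y′ , Y⊆Y′ , Y′⊆Y∪Z′ , ∣Y′∣≡C ←
    interpolate (p⊆p∪q Z′) ∣Y∣≤C (subst (_≤ ∣ Y ∪ Z′ ∣) ∣Z′∣≡C (∣q∣≤∣p∪q∣ Y Z′))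
  = Y′ , Z′ Vector.∷ M′ ,
    (λ { zero → (λ t∈T₀ → Z⊆Z′ (K⊆Z (p⊆p∪q _ t∈T₀))) , ∣Z′∣≡C ; (suc i) → M′∈𝐌 i }) ,
    Y⊆Y′ , ∣Y′∣≡C , (begin
  ∣ Z′ ─ Y′ ∣ + s Z′ M′ + C + (x + c)
    ≡⟨ solve 5 (λ d s C x c → d :+ s :+ C :+ (x :+ c) := (s :+ C :+ c) :+ (d :+ x)) refl ∣ Z′ ─ Y′ ∣ (s Z′ M′) C x c ⟩
  (s Z′ M′ + C + c) + (∣ Z′ ─ Y′ ∣ + x)
    -- Both states have size `C`, so as many tools are loaded as dropped. The tools filled into `Y′`
    -- come from `Z′`, so only tools of `Y ─ Z` are dropped.
    ≤⟨ +-mono-≤ bound (+-monoˡ-≤ x (begin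
      ∣ Z′ ─ Y′ ∣ ≡⟨ ∣p∣≡∣q∣⇒∣p─q∣≡∣q─p∣ Z′ Y′ (trans ∣Z′∣≡C (sym ∣Y′∣≡C)) ⟩
      ∣ Y′ ─ Z′ ∣ ≤⟨ p⊆q⇒∣p∣≤∣q∣ (dropped Z⊆Z′ Y′⊆Y∪Z′) ⟩
      ∣ Y ─ Z ∣   ∎)) ⟩
  (S + ∣ Z ∣) + (∣ Y ─ Z ∣ + x)
    ≡⟨ solve 4 (λ S z d x → (S :+ z) :+ (d :+ x) := (d :+ z) :+ (S :+ x)) refl S ∣ Z ∣ ∣ Y ─ Z ∣ x ⟩
  (∣ Y ─ Z ∣ + ∣ Z ∣) + (S + x)
    -- Held tools of `X` are already in `Y`, so the only tools added to form `Z` are those in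
    -- `T zero ─ X`, the uses that close no pipe.
    ≤⟨ +-monoˡ-≤ (S + x) (disjoint⇒∣p∣+∣q∣≤∣r∣+∣s∣ Y (T zero ─ X)
         (x∈p─q⇒x∉q Y Z) (λ t∈Y─Z → p⊆p∪q _ (p─q⊆p Y Z t∈Y─Z)) (loaded ∘ Z⊆K∪Y)) ⟩
  (∣ Y ∣ + r) + (S + x)
    ≡⟨ solve 4 (λ y r S x → (y :+ r) :+ (S :+ x) := ((x :+ r) :+ S) :+ y) refl ∣ Y ∣ r S x ⟩
  ((x + r) + S) + ∣ Y ∣
    ≡⟨ cong (λ k → k + S + ∣ Y ∣) (trans (∣p∣≡∣p∩q∣+∣p─q∣ (T zero) X) (cong (λ p → ∣ p ∣ + r) (∩-comm (T zero) X))) ⟨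
  (∣ T zero ∣ + S) + ∣ Y ∣ ∎)
  where
  open ≤-Reasoning
  open +-*-Solver
  K = held X (T zero) (M zero)
  S = sum λ i → ∣ T (suc i) ∣
  x = ∣ X ∩ T zero ∣
  r = ∣ T zero ─ X ∣
  c = pipeCount K (tail T) (tail M)
  s : Subset _ → Vector (Subset _) n → ℕ
  s Z′ M′ = switches (Z′ Vector.∷ M′)

  loaded : ∀ {t} → t ∈ K ∪ Y → t ∈ Y ∪ (T zero ─ X)
  loaded {t} t∈K∪Y with x∈p∪q⁻ K Y t∈K∪Y
  ... | inj₂ t∈Y = x∈p∪q⁺ (inj₁ t∈Y)
  ... | inj₁ t∈K with t ∈? X
  ...   | yes t∈X = x∈p∪q⁺ (inj₁ (X⊆Y t∈X))
  ...   | no  t∉X = x∈p∪q⁺ (inj₂ (x∈p∧x∉q⇒x∈p─q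
    ([ id , (λ t∈X∩M₀ → contradiction (p∩q⊆p X (M zero) t∈X∩M₀) t∉X) ]′ (x∈p∪q⁻ (T zero) _ t∈K)) t∉X))

  dropped : ∀ {Z Z′ Y′} → Z ⊆ Z′ → Y′ ⊆ Y ∪ Z′ → Y′ ─ Z′ ⊆ Y ─ Z
  dropped {Z} {Z′} {Y′} Z⊆Z′ Y′⊆Y∪Z′ t∈Y′─Z′ =
    let t∉Z′ = x∈p─q⇒x∉q Y′ Z′ t∈Y′─Z′ in
    x∈p∧x∉q⇒x∈p─q
      ([ id , (λ t∈Z′ → contradiction t∈Z′ t∉Z′) ]′ (x∈p∪q⁻ Y Z′ (Y′⊆Y∪Z′ (p─q⊆p Y′ Z′ t∈Y′─Z′))))
      (t∉Z′ ∘ Z⊆Z′)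

-- Existence of a maximal pipe count

-- Dynamic programming: the first state affects later jobs only through `held`, so each candidate is
-- extended by a best continuation and the best candidate is then chosen.
max-pipeCount : ∀ {C} X (T : Vector (Subset m) n) → C ≤ m → (∀ i → ∣ T i ∣ ≤ C) →
  ∃ λ M → 𝐌 C T M × (∀ N → 𝐌 C T N → pipeCount X T N ≤ pipeCount X T M)
max-pipeCount {n = zero} X T _ _ = T , (λ ()) , λ _ _ → z≤n
max-pipeCount {m} {suc n} {C} X T C≤m ∣T∣≤C
  with rest ← (λ p → max-pipeCount (held X (T zero) p) (tail T) C≤m (∣T∣≤C ∘ suc))
  with p , p-ok , p-max ← argmax
    (λ p → (T zero ⊆? p) ×-dec (∣ p ∣ ≟ C))
    (λ p → pipeCount X T (p Vector.∷ proj₁ (rest p)))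
    -- An admissible first state exists: `T zero` is enlarged inside `⊤` to size `C`, using `C ≤ m`.
    (let p , T₀⊆p , _ , ∣p∣≡C = interpolate ⊆⊤ (∣T∣≤C zero) (subst (C ≤_) (sym (∣⊤∣≡n m)) C≤m)
     in p , T₀⊆p , ∣p∣≡C)
  = p Vector.∷ proj₁ (rest p) ,
    (λ { zero → p-ok ; (suc i) → proj₁ (proj₂ (rest p)) i }) ,
    λ N N∈𝐌 → ≤-trans
      (+-monoʳ-≤ ∣ X ∩ T zero ∣ (proj₂ (proj₂ (rest (N zero))) (tail N) (N∈𝐌 ∘ suc)))
      (p-max (N zero) (N∈𝐌 zero))

-- The min-max identity

∈⋃⇒∈ : ∀ (T : Vector (Subset m) n) {t} → t ∈ ⋃ (toList T) → ∃ λ i → t ∈ T i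
∈⋃⇒∈ {n = zero}  T t∈⊥ = contradiction t∈⊥ ∉⊥
∈⋃⇒∈ {n = suc n} T t∈⋃ with x∈p∪q⁻ (T zero) _ t∈⋃
... | inj₁ t∈T₀ = zero , t∈T₀
... | inj₂ t∈⋃′ with i , t∈Ti ← ∈⋃⇒∈ (tail T) t∈⋃′ = suc i , t∈Ti

switches≤switches-∷ : ∀ Y (M : Vector (Subset m) n) → switches M ≤ switches (Y Vector.∷ M)
switches≤switches-∷ {n = zero}  Y M = z≤n
switches≤switches-∷ {n = suc n} Y M = m≤n+m (switches M) ∣ M zero ─ Y ∣

-- With `M zero` itself as the state before the first job, the first transition is free; with `X`
-- empty, all `C` tools of `M zero` start idle.
∑∣T∣≤switches+C+pipeCount : ∀ {C} (T M : Vector (Subset m) n) → 𝐌 C T M →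
  sum (λ i → ∣ T i ∣) ≤ switches M + C + pipeCount ⊥ T M
∑∣T∣≤switches+C+pipeCount {n = zero} T M _ = z≤n
∑∣T∣≤switches+C+pipeCount {m} {suc n} {C} T M M∈𝐌 = begin
  sum (λ i → ∣ T i ∣)
    ≤⟨ ∑∣T∣≤pipeCount+idle+switches ⊥ M₀ T M (proj₁ ∘ M∈𝐌) ⟩
  c + ∣ M₀ ─ ⊥ ∣ + (∣ M₀ ─ M₀ ∣ + switches M)
    ≡⟨ cong₂ (λ p k → c + p + (k + switches M)) (trans (cong ∣_∣ (p─⊥≡p M₀)) (proj₂ (M∈𝐌 zero))) ∣M₀─M₀∣≡0 ⟩
  c + C + switches M
    ≡⟨ solve 3 (λ c C s → c :+ C :+ s := s :+ C :+ c) refl c C (switches M) ⟩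
  switches M + C + c ∎
  where
  open ≤-Reasoning
  open +-*-Solver
  M₀ = M zero
  c  = pipeCount ⊥ T M
  ∣M₀─M₀∣≡0 : ∣ M₀ ─ M₀ ∣ ≡ 0
  ∣M₀─M₀∣≡0 = n≤0⇒n≡0 (subst (∣ M₀ ─ M₀ ∣ ≤_) (∣⊥∣≡0 m) (p⊆q⇒∣p∣≤∣q∣ {q = ⊥ {m}} λ t∈M₀─M₀ →
    contradiction (p─q⊆p M₀ M₀ t∈M₀─M₀) (x∈p─q⇒x∉q M₀ M₀ t∈M₀─M₀)))

theorem1 : ∀ (m n C : ℕ) (T : Vector (Subset m) n) →
    0 < C →
    ⋃ (toList T) ≡ ⊤ →
    (∀ i → ∣ T i ∣ ≤ C) →
    C < m →
    ∃₂ λ a b →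
    IsMin (Image switches (𝐌 C T)) a ×
    IsMax (Image (#pipes T) (𝐌 C T)) b ×
    + a ≡ + sum (λ i → ∣ T i ∣) - + C - + b
theorem1 m n C T _ ⋃T≡⊤ ∣T∣≤C C<m
  with M , M∈𝐌 , M-max ← max-pipeCount ⊥ T (<⇒≤ C<m) ∣T∣≤C
  -- The construction starts from an empty magazine, where the invariant holds because every tool is
  -- needed by some job.
  with Y′ , M′ , M′∈𝐌 , _ , _ , tight ← tight-states ⊥ ⊥ T M M∈𝐌 C<m id
    (≤-trans (≤-reflexive (∣⊥∣≡0 m)) z≤n)
    (inj₂ λ t → inj₂ (∈⋃⇒∈ T (subst (t ∈_) (sym ⋃T≡⊤) ∈⊤)))
  = a , b ,
    ((M′ , M′∈𝐌 , refl) , λ { _ (N , N∈𝐌 , refl) →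
      -- Both bounds carry the same `C` and `b`, the latter since `lower` replaces the pipe count of
      -- `N` by the maximum; cancelling them leaves the comparison of switches.
      +-cancelʳ-≤ C _ _ (+-cancelʳ-≤ b _ _ (≤-trans upper (lower N N∈𝐌))) }) ,
    ((M , M∈𝐌 , #pipes≡pipeCount T M) , λ { _ (N , N∈𝐌 , refl) →
      ≤-trans (≤-reflexive (#pipes≡pipeCount T N)) (M-max N N∈𝐌) }) ,
    a≡S-C-b
  where
  S = sum λ i → ∣ T i ∣
  a = switches M′
  b = pipeCount ⊥ T M

  upper : a + C + b ≤ S
  upper = begin
    a + C + b                       ≤⟨ +-monoˡ-≤ b (+-monoˡ-≤ C (switches≤switches-∷ Y′ M′)) ⟩
    switches (Y′ Vector.∷ M′) + C + b ≤⟨ tight ⟩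
    S + ∣ ⊥ {m} ∣                   ≡⟨ cong (_+_ S) (∣⊥∣≡0 m) ⟩
    S + 0                           ≡⟨ +-identityʳ S ⟩
    S                               ∎
    where open ≤-Reasoning

  lower : ∀ N → 𝐌 C T N → S ≤ switches N + C + b
  lower N N∈𝐌 = ≤-trans (∑∣T∣≤switches+C+pipeCount T N N∈𝐌)
    (+-monoʳ-≤ (switches N + C) (M-max N N∈𝐌))

  -- At `M′` the two bounds meet. The summands are ordered so that subtracting `C` and then `b`
  -- peels them off from the right.
  S≡a+b+C : S ≡ a + b + C
  S≡a+b+C = trans (≤-antisym (lower M′ M′∈𝐌) upper)
    (solve 3 (λ a C b → a :+ C :+ b := a :+ b :+ C) refl a C b)
    where open +-*-Solver

  [m+n]-n : ∀ m n → + (m + n) - + n ≡ + m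
  [m+n]-n m n = trans ([+m]-[+n]≡m⊖n (m + n) n) (trans (⊖-≥ (m≤n+m n m)) (cong +_ (m+n∸n≡m m n)))

  a≡S-C-b : + a ≡ + S - + C - + b
  a≡S-C-b = sym (trans (cong (λ k → + k - + C - + b) S≡a+b+C)
    (trans (cong (_- + b) ([m+n]-n (a + b) C)) ([m+n]-n a b)))
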